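{- Let $Q_{\omega_4}:=Q_6+Q_4+Q_2$. Then $Q_{\omega_4}$ is a polynomial of degree $6$, and for every nonzero $x\in V_8$ we have $Q_{\omega_4}(x)=0$ if and only if $x\in\omega_4$; i.e. $\omega_4$ has the sextic equation $Q_{\omega_4}(x)=0$.
   Context: Work over $\mathbb{F}_2$. Let $V_8=V(8,2)$ with basis $e_1,\dots,e_8$ and coordinates $x=\sum x_ie_i$; put $V_a=\langle e_1,e_8\rangle$, $V_b=\langle e_2,e_7\rangle$, $V_c=\langle e_3,e_6\rangle$, $V_d=\langle e_4,e_5\rangle$. Points of $\operatorname{PG}(7,2)$ are nonzero vectors. The line-weight of $x=x_a+x_b+x_c+x_d$ ($x_h\in V_h$) is the number of nonzero $x_h$; $\omega_4$ is the set of points of line-weight 4 ($81$ points). For a subspace $W$ which is a sum of some of the $V_h$, let $F_W(x)=1+\prod_{i:\,e_i\notin W}(1+x_i)$, a polynomial of degree $\operatorname{codim}W$ which, on nonzero vectors, vanishes exactly on $W$. Write $F_{hkl}=F_{V_h\oplus V_k\oplus V_l}$ (degree 2), $F_{hk}=F_{V_h\oplus V_k}$ (degree 4), $F_h=F_{V_h}$ (degree 6). Define $Q_2=F_{abc}+F_{abd}+F_{acd}+F_{bcd}$, $Q_4=F_{ab}+F_{ac}+F_{ad}+F_{bc}+F_{bd}+F_{cd}$, $Q_6=F_a+F_b+F_c+F_d$. -}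

module Defs where

open import Data.Bool using (Bool; true; false; _xor_; _∧_; not; if_then_else_)
open import Data.Nat using (ℕ; zero; suc; _⊔_)
open import Data.Fin using (Fin; zero; suc; toℕ)
open import Data.Vec using (Vec; []; _∷_; lookup; replicate)
open import Data.List using (List; []; _∷_; foldr; filter; allFin)
open import Relation.Nullary using (¬_)
open import Relation.Binary.PropositionalEquality using (_≡_)
open import Relation.Nullary.Decidable using (Dec; yes; no)

-- Reduced (multilinear) polynomials over F₂ in n variables x₀ … x_{n-1}.
-- Poly (suc n) ∋ (p₀ , p₁) represents p₀ + x₀ · p₁, where p₀, p₁ are
-- polynomials in the remaining variables x₁ … x_n (shifted down by one).
-- Since x² = x as functions on F₂, this is the canonical representation
-- of polynomial functions F₂ⁿ → F₂ (algebraic normal form).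

data Poly : ℕ → Set where
  cst  : Bool → Poly zero
  node : ∀ {n} → Poly n → Poly n → Poly (suc n)

𝟘 : ∀ {n} → Poly n
𝟘 {zero}  = cst false
𝟘 {suc n} = node 𝟘 𝟘

𝟙 : ∀ {n} → Poly n
𝟙 {zero}  = cst true
𝟙 {suc n} = node 𝟙 𝟘

var : ∀ {n} → Fin n → Poly n
var zero    = node 𝟘 𝟙
var (suc i) = node (var i) 𝟘

infixl 6 _⊕_
infixl 7 _⊗_

_⊕_ : ∀ {n} → Poly n → Poly n → Poly n
cst a ⊕ cst b = cst (a xor b)
node p₀ p₁ ⊕ node q₀ q₁ = node (p₀ ⊕ q₀) (p₁ ⊕ q₁)

-- multiplication, reduced with x² = x:
-- (p₀ + x p₁)(q₀ + x q₁) = p₀q₀ + x (p₀q₁ + p₁q₀ + p₁q₁)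
_⊗_ : ∀ {n} → Poly n → Poly n → Poly n
cst a ⊗ cst b = cst (a ∧ b)
node p₀ p₁ ⊗ node q₀ q₁ = node (p₀ ⊗ q₀) (p₀ ⊗ q₁ ⊕ p₁ ⊗ q₀ ⊕ p₁ ⊗ q₁)

eval : ∀ {n} → Poly n → Vec Bool n → Bool
eval (cst a) [] = a
eval (node p₀ p₁) (b ∷ xs) = eval p₀ xs xor (b ∧ eval p₁ xs)

isZero : ∀ {n} → Poly n → Bool
isZero (cst a) = not a
isZero (node p₀ p₁) = isZero p₀ ∧ isZero p₁

-- total degree of the reduced polynomial (convention: deg 0 = 0)
deg : ∀ {n} → Poly n → ℕ
deg (cst a) = zero
deg (node p₀ p₁) = if isZero p₁ then deg p₀ else (deg p₀ ⊔ suc (deg p₁))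

-- The setting: V₈ = F₂⁸, coordinates x₁ … x₈ stored at positions 0 … 7.
-- Blocks V_a = ⟨e₁,e₈⟩, V_b = ⟨e₂,e₇⟩, V_c = ⟨e₃,e₆⟩, V_d = ⟨e₄,e₅⟩.

V8 : Set
V8 = Vec Bool 8

data Block : Set where
  a b c d : Block

-- the block containing basis vector e_{i+1}
blockOfℕ : ℕ → Block
blockOfℕ 0 = a
blockOfℕ 1 = b
blockOfℕ 2 = c
blockOfℕ 3 = d
blockOfℕ 4 = d
blockOfℕ 5 = c
blockOfℕ 6 = b
blockOfℕ _ = a

blockOf : Fin 8 → Block
blockOf i = blockOfℕ (toℕ i)

_==ᴮ_ : Block → Block → Bool
a ==ᴮ a = true
b ==ᴮ b = true
c ==ᴮ c = true
d ==ᴮ d = true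
_ ==ᴮ _ = false

memᴮ : Block → List Block → Bool
memᴮ h [] = false
memᴮ h (k ∷ ks) = if h ==ᴮ k then true else memᴮ h ks

-- W given by the list of blocks it is the sum of; e_i ∈ W iff its block is listed
inW : List Block → Fin 8 → Bool
inW W i = memᴮ (blockOf i) W

F : List Block → Poly 8
F W = 𝟙 ⊕ foldr (λ i acc → (𝟙 ⊕ var i) ⊗ acc) 𝟙 (filter (λ i → notDec (inW W i)) (allFin 8))
  where
  notDec : (β : Bool) → Dec (β ≡ false)
  notDec false = yes _≡_.refl
  notDec true  = no (λ ())

Q₂ : Poly 8
Q₂ = F (a ∷ b ∷ c ∷ []) ⊕ F (a ∷ b ∷ d ∷ []) ⊕ F (a ∷ c ∷ d ∷ []) ⊕ F (b ∷ c ∷ d ∷ [])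

Q₄ : Poly 8
Q₄ = F (a ∷ b ∷ []) ⊕ F (a ∷ c ∷ []) ⊕ F (a ∷ d ∷ []) ⊕ F (b ∷ c ∷ []) ⊕ F (b ∷ d ∷ []) ⊕ F (c ∷ d ∷ [])

Q₆ : Poly 8
Q₆ = F (a ∷ []) ⊕ F (b ∷ []) ⊕ F (c ∷ []) ⊕ F (d ∷ [])

Qω₄ : Poly 8
Qω₄ = Q₆ ⊕ Q₄ ⊕ Q₂

_∨ᴮ_ : Bool → Bool → Bool
true ∨ᴮ _ = true
false ∨ᴮ β = β

-- is the component x_h (coordinates i, j of block h) nonzero?
nz : V8 → Fin 8 → Fin 8 → ℕ
nz x i j = if lookup x i ∨ᴮ lookup x j then 1 else 0

lineWeight : V8 → ℕ
lineWeight x = nz x zero (suc (suc (suc (suc (suc (suc (suc zero)))))))     -- x_a : e₁, e₈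
             Data.Nat.+ nz x (suc zero) (suc (suc (suc (suc (suc (suc zero))))))   -- x_b : e₂, e₇
             Data.Nat.+ nz x (suc (suc zero)) (suc (suc (suc (suc (suc zero)))))   -- x_c : e₃, e₆
             Data.Nat.+ nz x (suc (suc (suc zero))) (suc (suc (suc (suc zero)))) -- x_d : e₄, e₅

ω₄ : V8 → Set
ω₄ x = lineWeight x ≡ 4

Nonzero : V8 → Set
Nonzero x = ¬ (x ≡ replicate 8 false)

module Submission where

open import Defs
open import Data.Bool using (Bool; true; false; _xor_)
open import Data.Bool.Properties using (xor-identityʳ) renaming (_≟_ to _≟ᵇ_)
open import Data.Bool.Solver using (module xor-∧-Solver)
open import Data.Nat using (_≟_)
open import Data.Product using (_×_; _,_)
open import Data.Vec using (Vec; []; _∷_; replicate)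
open import Data.Vec.Properties using (≡-dec)
open import Function.Bundles using (_⇔_; mk⇔; Equivalence)
open import Level using (Level)
open import Relation.Binary.Core using (REL)
open import Relation.Binary.Definitions using (Decidable)
open import Relation.Binary.PropositionalEquality using (_≡_; refl; sym; subst)
open import Relation.Nullary.Decidable using (Dec; map′; toWitness; ¬?; _×-dec_; _→-dec_)

-- Let S be the set of blocks where x is nonzero, and w its size. `F W` is 0 at x exactly when W
-- contains S. The fourteen summands of `Qω₄` run over the nonempty proper sets of blocks; fourteen
-- being even, `Qω₄` at x is the parity of the number of proper supersets of S, which is 2^(4-w) - 1
-- for w > 0: even only when w = 4. The four summands of `Q₆` have distinct top monomials of degree
-- 6. The formal proof does not count: it decides both claims by evaluation.

private
  variable
    p q : Level
    P : Set p
    Q : Set q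

_⇔-dec_ : Dec P → Dec Q → Dec (P ⇔ Q)
P? ⇔-dec Q? = map′
  (λ (to , from) → mk⇔ to from)
  (λ P⇔Q → Equivalence.to P⇔Q , Equivalence.from P⇔Q)
  ((P? →-dec Q?) ×-dec (Q? →-dec P?))

-- Additivity makes `f₀ ⊕ f₁` the restriction of `node f₀ f₁` to leading coordinate 1.
eval-⊕ : ∀ {n} (f g : Poly n) x → eval (f ⊕ g) x ≡ eval f x xor eval g x
eval-⊕ (cst _) (cst _) [] = refl
eval-⊕ (node f₀ f₁) (node g₀ g₁) (β ∷ x) rewrite eval-⊕ f₀ g₀ x | eval-⊕ f₁ g₁ x =
  solve 5 (λ β f₀ f₁ g₀ g₁ →
      (f₀ :+ g₀) :+ β :* (f₁ :+ g₁) := (f₀ :+ β :* f₁) :+ (g₀ :+ β :* g₁))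
    refl β (eval f₀ x) (eval f₁ x) (eval g₀ x) (eval g₁ x)
  where open xor-∧-Solver

eval-false : ∀ {n} (f₀ f₁ : Poly n) x → eval (node f₀ f₁) (false ∷ x) ≡ eval f₀ x
eval-false f₀ f₁ x = xor-identityʳ (eval f₀ x)

eval-true : ∀ {n} (f₀ f₁ : Poly n) x → eval (node f₀ f₁) (true ∷ x) ≡ eval (f₀ ⊕ f₁) x
eval-true f₀ f₁ x = sym (eval-⊕ f₀ f₁ x)

-- Specialising one variable at a time lets all 2ⁿ points share a single
-- normalisation of f; deciding R x (eval f x) point by point would repeat it 2ⁿ times.
allValues? : ∀ {n r} {R : REL (Vec Bool n) Bool r} →
             Decidable R → (f : Poly n) → Dec (∀ x → R x (eval f x))
allValues? R? (cst β) = map′ (λ { r [] → r }) (λ h → h []) (R? [] β)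
allValues? {R = R} R? (node f₀ f₁) = map′
  (λ { (h₀ , h₁) (false ∷ x) → subst (R _) (sym (eval-false f₀ f₁ x)) (h₀ x)
     ; (h₀ , h₁) (true ∷ x)  → subst (R _) (sym (eval-true f₀ f₁ x)) (h₁ x) })
  (λ h → (λ x → subst (R _) (eval-false f₀ f₁ x) (h (false ∷ x)))
       , (λ x → subst (R _) (eval-true f₀ f₁ x) (h (true ∷ x))))
  (allValues? (λ x → R? (false ∷ x)) f₀ ×-dec allValues? (λ x → R? (true ∷ x)) (f₀ ⊕ f₁))

IsSexticOfω₄ : Poly 8 → Set
IsSexticOfω₄ f = (deg f ≡ 6) × ((x : V8) → Nonzero x → ((eval f x ≡ false) ⇔ ω₄ x))

isSexticOfω₄? : ∀ f → Dec (IsSexticOfω₄ f)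
isSexticOfω₄? f = (deg f ≟ 6) ×-dec allValues?
  -- `β` stands for the value at `x`, already reduced to a constant when this test runs.
  (λ x β → ¬? (≡-dec _≟ᵇ_ x (replicate 8 false))
             →-dec ((β ≟ᵇ false) ⇔-dec (lineWeight x ≟ 4)))
  f

theorem2 : (deg Qω₄ ≡ 6)
    × ((x : V8) → Nonzero x → ((eval Qω₄ x ≡ false) ⇔ ω₄ x))
-- The `_` is solved only if the decision over all 256 vectors normalises to yes.
theorem2 = toWitness {a? = isSexticOfω₄? Qω₄} _
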